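{- For every odd number $n\ge 3$, \[\mathcal{P}^{(n)}=\bigcup_{v\in T^{(n)}}\frac{1}{2}\left(v+\mathcal{P}^{(n)}\right),\] where $T^{(n)}=\{(x_1,x_2,\dots,x_n)\in\{0,1\}^n : x_1\oplus x_2\oplus\dots\oplus x_n=0\}$.
   Context: $\mathbb{N}$ denotes the non-negative integers, and $\oplus$ denotes the bitwise exclusive OR (Nim-sum) of non-negative integers. For $m\ge 0$ let \[P_m^{(n)}=\{(x_1,\dots,x_n)\in\mathbb{N}^n : x_i<2^m \text{ for } 1\le i\le n \text{ and } x_1\oplus x_2\oplus\dots\oplus x_n=0\}.\] The scaled sets $\frac{1}{2^m}P_m^{(n)}\subset[0,1)^n$ are increasing in $m$, and \[\mathcal{P}^{(n)}:=\lim_{m\to\infty}\frac{1}{2^m}P_m^{(n)}=\bigcup_{m=0}^{\infty}\frac{1}{2^m}P_m^{(n)}\subset\mathbb{R}^n.\] For $A\subset\mathbb{R}^n$, $v\in\mathbb{R}^n$ and $a\in\mathbb{R}$, $a(v+A):=\{a(v+x) : x\in A\}$. -}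

module Defs where

open import Level using (0ℓ)
open import Data.Integer using (+_)
open import Data.Nat as ℕ using (ℕ; zero; suc; _<_)
open import Data.Nat.DivMod using (_/_; _%_)
open import Data.Nat.Properties using (m^n≢0)
open import Data.Product using (∃-syntax; _×_)
open import Data.Rational as ℚ using (ℚ)
open import Data.Sum using (_⊎_)
open import Data.Vec using (Vec; foldr′; map; zipWith)
open import Data.Vec.Relation.Unary.All using (All)
open import Relation.Binary.PropositionalEquality using (_≡_; refl)
open import Relation.Unary using (Pred; _∈_; ⋃)

infixl 6 _⊕_ _+ᵥ_ _+ₛ_
infixr 7 _*ᵥ_ _*ₛ_

-- Bitwise exclusive or of the k lowest binary digits: the lowest digit of the
-- result is the sum modulo 2 of the lowest digits of x and y, and the other
-- digits are obtained by dropping these.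
xorBits : (k x y : ℕ) → ℕ
xorBits zero    x y = 0
xorBits (suc k) x y = (x ℕ.+ y) % 2 ℕ.+ 2 ℕ.* xorBits k (x / 2) (y / 2)

-- Neither x nor y has more than x + y binary digits, so none is lost.
_⊕_ : ℕ → ℕ → ℕ
x ⊕ y = xorBits (x ℕ.+ y) x y

_ : 12 ⊕ 10 ≡ 6
_ = refl

nimSum : ∀ {n} → Vec ℕ n → ℕ
nimSum = foldr′ _⊕_ 0

P : (n m : ℕ) → Pred (Vec ℕ n) 0ℓ
P n m x = All (_< 2 ℕ.^ m) x × nimSum x ≡ 0

T : (n : ℕ) → Pred (Vec ℕ n) 0ℓ
T n x = All (λ xᵢ → xᵢ ≡ 0 ⊎ xᵢ ≡ 1) x × nimSum x ≡ 0

-- All the points of the sets below have dyadic rational coordinates, so these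
-- subsets of ℝⁿ are formed inside ℚⁿ.

ℚ^ : ℕ → Set
ℚ^ n = Vec ℚ n

ι : ∀ {n} → Vec ℕ n → ℚ^ n
ι = map (λ k → + k ℚ./ 1)

_+ᵥ_ : ∀ {n} → ℚ^ n → ℚ^ n → ℚ^ n
_+ᵥ_ = zipWith ℚ._+_

_*ᵥ_ : ∀ {n} → ℚ → ℚ^ n → ℚ^ n
a *ᵥ x = map (a ℚ.*_) x

ι[_] : ∀ {n} → Pred (Vec ℕ n) 0ℓ → Pred (ℚ^ n) 0ℓ
ι[ A ] y = ∃[ x ] x ∈ A × y ≡ ι x

_+ₛ_ : ∀ {n} → ℚ^ n → Pred (ℚ^ n) 0ℓ → Pred (ℚ^ n) 0ℓ
(v +ₛ A) y = ∃[ x ] x ∈ A × y ≡ v +ᵥ x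

_*ₛ_ : ∀ {n} → ℚ → Pred (ℚ^ n) 0ℓ → Pred (ℚ^ n) 0ℓ
(a *ₛ A) y = ∃[ x ] x ∈ A × y ≡ a *ᵥ x

1/2^_ : ℕ → ℚ
1/2^ m = ℚ._/_ (+ 1) (2 ℕ.^ m) {{m^n≢0 2 m}}

-- The sets (1/2^ m) *ₛ ι[ P n m ] increase with m, so that their limit is
-- their union.
𝒫 : (n : ℕ) → Pred (ℚ^ n) 0ℓ
𝒫 n = ⋃[ m ∶ ℕ ] ((1/2^ m) *ₛ ι[ P n m ])

{-# OPTIONS --safe #-}
-- Splitting off the highest of m + 1 binary digits, xᵢ = vᵢ 2ᵐ + rᵢ, turns
-- xᵢ / 2ᵐ⁺¹ into ½ (vᵢ + rᵢ / 2ᵐ).  The nim-sum acts on each digit separately,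
-- so it vanishes on x exactly when it vanishes on both v and r.
module Submission where

open import Defs
open import Data.Nat using (ℕ; _≥_)
open import Data.Nat.Divisibility using (_∣_)
open import Data.Product using (∃; proj₁)
open import Data.Rational using (½)
open import Relation.Nullary using (¬_)
open import Relation.Unary using (_≐_; ⋃)

import Data.Integer as ℤ
import Data.Integer.Properties as ℤ
open import Data.Nat
  using (zero; suc; _+_; _*_; _^_; _≤_; _<_; z≤n; s≤s; NonZero)
open import Data.Nat.DivMod
  using (_/_; _%_; m/n<m; m/n≤m; m%n<n; m<n*o⇒m/o<n; m*n/n≡m; +-distrib-/-∣ˡ; [m+kn]%n≡m%n;
         m≡m%n+[m/n]*n)
open import Data.Nat.Divisibility using (n∣m*n)
open import Data.Nat.Properties
open import Data.Nat.Solver as ℕSolver using ()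
open import Data.Product using (_×_; _,_)
import Data.Rational as ℚ
import Data.Rational.Properties as ℚ
open import Data.Rational.Unnormalised using (ℚᵘ; *≡*)
import Data.Rational.Unnormalised as ℚᵘ
import Data.Rational.Unnormalised.Properties as ℚᵘ
open import Data.Sum using (_⊎_; inj₁; inj₂)
open import Data.Vec using (Vec; []; _∷_; map; zipWith)
open import Data.Vec.Relation.Unary.All as All using (All; []; _∷_)
open import Data.Vec.Relation.Unary.All.Properties using (map⁺)
open import Relation.Binary.PropositionalEquality
  using (_≡_; refl; sym; trans; cong; cong₂; subst; module ≡-Reasoning)

private
  variable
    n k l x y r s : ℕ

-- Nim-sum, one binary digit at a time.

n/2≤k : x ≤ suc k → x / 2 ≤ k
n/2≤k {zero}  _   = z≤n
n/2≤k {suc x} x≤k = ≤-pred (≤-trans (m/n<m (suc x) 2 (s≤s (s≤s z≤n))) x≤k)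

xorBits-0-0 : ∀ k → xorBits k 0 0 ≡ 0
xorBits-0-0 zero    = refl
xorBits-0-0 (suc k) = cong (2 *_) (xorBits-0-0 k)

-- Halving lowers a bound on the arguments by one, in step with the digit count, so any further
-- digits are those of 0 and 0. This frees `_⊕_` from its particular count `x + y`.
xorBits-cong : x ≤ k → y ≤ k → x ≤ l → y ≤ l → xorBits k x y ≡ xorBits l x y
xorBits-cong {k = zero}  {l = l}     z≤n z≤n _   _   = sym (xorBits-0-0 l)
xorBits-cong {k = suc k} {l = zero}  _   _   z≤n z≤n = xorBits-0-0 (suc k)
xorBits-cong {x} {suc k} {y} {suc l} x≤k y≤k x≤l y≤l =
  cong (λ z → (x + y) % 2 + 2 * z)
    (xorBits-cong (n/2≤k x≤k) (n/2≤k y≤k) (n/2≤k x≤l) (n/2≤k y≤l))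

⊕-unfold : ∀ x y → x ⊕ y ≡ (x + y) % 2 + 2 * (x / 2 ⊕ y / 2)
⊕-unfold x y = begin
  xorBits (x + y) x y
    -- The count is raised to `suc (x + y)`, so that `xorBits` unfolds once by definition.
    ≡⟨ xorBits-cong x≤ y≤ (m≤n⇒m≤1+n x≤) (m≤n⇒m≤1+n y≤) ⟩
  (x + y) % 2 + 2 * xorBits (x + y) (x / 2) (y / 2)
    ≡⟨ cong (λ z → (x + y) % 2 + 2 * z)
         (xorBits-cong (≤-trans (m/n≤m x 2) x≤) (≤-trans (m/n≤m y 2) y≤)
                       (m≤m+n (x / 2) (y / 2)) (m≤n+m (y / 2) (x / 2))) ⟩
  (x + y) % 2 + 2 * (x / 2 ⊕ y / 2) ∎
  where
  open ≡-Reasoning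
  x≤ : x ≤ x + y
  x≤ = m≤m+n x y
  y≤ : y ≤ x + y
  y≤ = m≤n+m y x

n/2<2^m : ∀ m → r < 2 ^ suc m → r / 2 < 2 ^ m
n/2<2^m {r} m r< = m<n*o⇒m/o<n (subst (r <_) (*-comm 2 (2 ^ m)) r<)

⊕-<2^m : ∀ m → r < 2 ^ m → s < 2 ^ m → r ⊕ s < 2 ^ m
⊕-<2^m {zero}  {zero} zero _ _ = s≤s z≤n
⊕-<2^m {suc r} {_}    zero (s≤s ()) _
⊕-<2^m {_} {suc s}    zero _ (s≤s ())
⊕-<2^m {r} {s} (suc m) r< s< = begin-strict
  r ⊕ s                              ≡⟨ ⊕-unfold r s ⟩
  (r + s) % 2 + 2 * (r / 2 ⊕ s / 2)  <⟨ +-monoˡ-< _ (m%n<n (r + s) 2) ⟩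
  2 + 2 * (r / 2 ⊕ s / 2)            ≡⟨ *-suc 2 (r / 2 ⊕ s / 2) ⟨
  -- The strict bound on the halves absorbs the 2 that bounds the lowest digit.
  2 * suc (r / 2 ⊕ s / 2)            ≤⟨ *-monoʳ-≤ 2 (⊕-<2^m m (n/2<2^m m r<) (n/2<2^m m s<)) ⟩
  2 * 2 ^ m                          ∎
  where open ≤-Reasoning

-- Nim-sum of numbers cut into high and low digits.

-- The m binary digits of r < 2ᵐ placed below those of a.
append : (m a r : ℕ) → ℕ
append m a r = a * 2 ^ m + r

append-/2 : ∀ m a r → append (suc m) a r / 2 ≡ append m a (r / 2)
append-/2 m a r = begin
  (a * (2 * 2 ^ m) + r) / 2       ≡⟨ cong (λ z → (z + r) / 2) (x∙yz≈xz∙y a 2 (2 ^ m)) ⟩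
  (a * 2 ^ m * 2 + r) / 2         ≡⟨ +-distrib-/-∣ˡ r (n∣m*n (a * 2 ^ m)) ⟩
  (a * 2 ^ m * 2) / 2 + r / 2     ≡⟨ cong (_+ r / 2) (m*n/n≡m (a * 2 ^ m) 2) ⟩
  a * 2 ^ m + r / 2               ∎
  where
  open ≡-Reasoning
  open import Algebra.Properties.CommutativeSemigroup *-commutativeSemigroup using (x∙yz≈xz∙y)

append-%2 : ∀ m a b r s → (append (suc m) a r + append (suc m) b s) % 2 ≡ (r + s) % 2
append-%2 m a b r s = begin
  (a * (2 * p) + r + (b * (2 * p) + s)) % 2  ≡⟨ cong (_% 2) (regroup a b p r s) ⟩
  (r + s + (a + b) * p * 2) % 2              ≡⟨ [m+kn]%n≡m%n (r + s) ((a + b) * p) 2 ⟩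
  (r + s) % 2                                ∎
  where
  open ≡-Reasoning
  open ℕSolver.+-*-Solver
  p : ℕ
  p = 2 ^ m
  regroup : ∀ a b p r s → a * (2 * p) + r + (b * (2 * p) + s) ≡ r + s + (a + b) * p * 2
  regroup = solve 5 (λ a b p r s →
    a :* (con 2 :* p) :+ r :+ (b :* (con 2 :* p) :+ s) :=
    r :+ s :+ (a :+ b) :* p :* con 2) refl

-- Induction on `m`, peeling off the lowest digit, which depends on `r` and `s` alone because the
-- shifted `a` and `b` are even. At `m = 0` the bounds force `r` and `s` to be 0.
⊕-append : ∀ m a b → r < 2 ^ m → s < 2 ^ m →
           append m a r ⊕ append m b s ≡ append m (a ⊕ b) (r ⊕ s)
⊕-append {suc _} zero _ _ (s≤s ()) _
⊕-append {zero} {suc _} zero _ _ _ (s≤s ())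
⊕-append {zero} {zero} zero a b _ _ = begin
  (a * 1 + 0) ⊕ (b * 1 + 0)  ≡⟨ cong₂ _⊕_ (append-0 a) (append-0 b) ⟩
  a ⊕ b                      ≡⟨ append-0 (a ⊕ b) ⟨
  (a ⊕ b) * 1 + 0            ∎
  where
  open ≡-Reasoning
  append-0 : ∀ a → a * 1 + 0 ≡ a
  append-0 a = trans (+-identityʳ (a * 1)) (*-identityʳ a)
⊕-append {r} {s} (suc m) a b r< s< = begin
  X ⊕ Y
    ≡⟨ ⊕-unfold X Y ⟩
  (X + Y) % 2 + 2 * (X / 2 ⊕ Y / 2)
    ≡⟨ cong₂ (λ d z → d + 2 * z) (append-%2 m a b r s)
         (cong₂ _⊕_ (append-/2 m a r) (append-/2 m b s)) ⟩
  (r + s) % 2 + 2 * (append m a (r / 2) ⊕ append m b (s / 2))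
    ≡⟨ cong (λ z → (r + s) % 2 + 2 * z) (⊕-append m a b (n/2<2^m m r<) (n/2<2^m m s<)) ⟩
  (r + s) % 2 + 2 * append m (a ⊕ b) (r / 2 ⊕ s / 2)
    ≡⟨ regroup ((r + s) % 2) (a ⊕ b) (2 ^ m) (r / 2 ⊕ s / 2) ⟩
  append (suc m) (a ⊕ b) ((r + s) % 2 + 2 * (r / 2 ⊕ s / 2))
    ≡⟨ cong (append (suc m) (a ⊕ b)) (⊕-unfold r s) ⟨
  append (suc m) (a ⊕ b) (r ⊕ s) ∎
  where
  open ≡-Reasoning
  open ℕSolver.+-*-Solver
  X Y : ℕ
  X = append (suc m) a r
  Y = append (suc m) b s
  regroup : ∀ d c p z → d + 2 * (c * p + z) ≡ c * (2 * p) + (d + 2 * z)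
  regroup = solve 4 (λ d c p z →
    d :+ con 2 :* (c :* p :+ z) := c :* (con 2 :* p) :+ (d :+ con 2 :* z)) refl

nimSum-<2^m : ∀ m {x : Vec ℕ n} → All (_< 2 ^ m) x → nimSum x < 2 ^ m
nimSum-<2^m m []         = m^n>0 2 m
nimSum-<2^m m (x< ∷ xs<) = ⊕-<2^m m x< (nimSum-<2^m m xs<)

nimSum-append : ∀ m (v : Vec ℕ n) {r : Vec ℕ n} → All (_< 2 ^ m) r →
                nimSum (zipWith (append m) v r) ≡ append m (nimSum v) (nimSum r)
nimSum-append m []      []         = refl
nimSum-append m (a ∷ v) (r< ∷ rs<) =
  trans (cong (append m a _ ⊕_) (nimSum-append m v rs<))
        (⊕-append m a (nimSum v) r< (nimSum-<2^m m rs<))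

-- Joining and splitting the points of `P`.

append-∈-P : ∀ m {v r : Vec ℕ n} → T n v → P n m r → P n (suc m) (zipWith (append m) v r)
append-∈-P m {v} {r} (v∈ , Σv≡0) (r< , Σr≡0) =
  append-< v∈ r< ,
  trans (nimSum-append m v r<) (cong₂ (append m) Σv≡0 Σr≡0)
  where
  append-< : ∀ {n} {v r : Vec ℕ n} → All (λ a → a ≡ 0 ⊎ a ≡ 1) v → All (_< 2 ^ m) r →
             All (_< 2 ^ suc m) (zipWith (append m) v r)
  append-< []               []         = []
  append-< (inj₁ refl ∷ v∈) (r< ∷ rs<) = ≤-trans r< (m≤m+n _ _) ∷ append-< v∈ rs<
  -- `2 ^ suc m` unfolds to `2 ^ m + (2 ^ m + 0)`, compared summand by summand with
  -- `(2 ^ m + 0) + r`.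
  append-< (inj₂ refl ∷ v∈) (r< ∷ rs<) =
    +-mono-≤-< (≤-reflexive (+-identityʳ (2 ^ m))) (≤-trans r< (m≤m+n _ 0)) ∷ append-< v∈ rs<

<2⇒≡0⊎≡1 : x < 2 → x ≡ 0 ⊎ x ≡ 1
<2⇒≡0⊎≡1 {0} _ = inj₁ refl
<2⇒≡0⊎≡1 {1} _ = inj₂ refl
<2⇒≡0⊎≡1 {suc (suc _)} (s≤s (s≤s ()))

-- Division by `2 ^ m` gives the parts: entries below `2 ^ suc m` have quotients below 2.
P-split : ∀ m {x : Vec ℕ n} → P n (suc m) x →
          ∃ λ v → ∃ λ r → T n v × P n m r × x ≡ zipWith (append m) v r
P-split {n} m {x} (x< , Σx≡0) =
  map (_/ 2 ^ m) x , map (_% 2 ^ m) x ,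
  (map⁺ (All.map (λ x<′ → <2⇒≡0⊎≡1 (m<n*o⇒m/o<n x<′)) x<) , Σv≡0) , (ρ< , Σρ≡0) , split x
  where
  instance
    2^m≢0 : NonZero (2 ^ m)
    2^m≢0 = m^n≢0 2 m
  v ρ : Vec ℕ n
  v = map (_/ 2 ^ m) x
  ρ = map (_% 2 ^ m) x
  ρ< : All (_< 2 ^ m) ρ
  ρ< = map⁺ (All.universal (λ k → m%n<n k (2 ^ m)) x)
  split : ∀ {n} (x : Vec ℕ n) → x ≡ zipWith (append m) (map (_/ 2 ^ m) x) (map (_% 2 ^ m) x)
  split []      = refl
  split (k ∷ x) =
    cong₂ _∷_ (trans (m≡m%n+[m/n]*n k (2 ^ m)) (+-comm (k % 2 ^ m) _)) (split x)
  Σ≡0 : append m (nimSum v) (nimSum ρ) ≡ 0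
  Σ≡0 = trans (sym (nimSum-append m v ρ<)) (trans (cong nimSum (sym (split x))) Σx≡0)
  -- A sum of naturals vanishes only if both summands do, and `2 ^ m` is nonzero.
  Σv≡0 : nimSum v ≡ 0
  Σv≡0 = m*n≡0⇒m≡0 (nimSum v) (2 ^ m) (m+n≡0⇒m≡0 _ Σ≡0)
  Σρ≡0 : nimSum ρ ≡ 0
  Σρ≡0 = m+n≡0⇒n≡0 (nimSum v * 2 ^ m) Σ≡0

-- Rational arithmetic of the scaling.

-- Reduction to lowest terms blocks computation in `ℚ` for a variable `d`, so the identity is
-- checked in `ℚᵘ`. There `d`, which stands for `2 ^ m`, computes once it is matched as `suc c`.
½-append : ∀ d .{{_ : NonZero d}} .{{_ : NonZero (2 * d)}} a r →
           (ℤ.+ 1 ℚ./ (2 * d)) ℚ.* (ℤ.+ (a * d + r) ℚ./ 1) ≡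
           ½ ℚ.* ((ℤ.+ a ℚ./ 1) ℚ.+ (ℤ.+ 1 ℚ./ d) ℚ.* (ℤ.+ r ℚ./ 1))
½-append d@(suc c) a r = ℚ.toℚᵘ-injective (begin
  ℚ.toℚᵘ (1/2d ℚ.* N)
    ≈⟨ ℚ.toℚᵘ-homo-* 1/2d N ⟩
  ℚ.toℚᵘ 1/2d ℚᵘ.* ℚ.toℚᵘ N
    ≈⟨ ℚᵘ.*-cong (ℚ.toℚᵘ-fromℚᵘ 1/2dᵘ) (ℚ.toℚᵘ-fromℚᵘ Nᵘ) ⟩
  1/2dᵘ ℚᵘ.* Nᵘ
    ≈⟨ *≡* cross ⟩
  ℚᵘ.½ ℚᵘ.* (aᵘ ℚᵘ.+ 1/dᵘ ℚᵘ.* rᵘ)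
    ≈⟨ ℚᵘ.*-congˡ {ℚᵘ.½} (ℚᵘ.+-cong (ℚ.toℚᵘ-fromℚᵘ aᵘ)
         (ℚᵘ.*-cong (ℚ.toℚᵘ-fromℚᵘ 1/dᵘ) (ℚ.toℚᵘ-fromℚᵘ rᵘ))) ⟨
  ℚᵘ.½ ℚᵘ.* (ℚ.toℚᵘ A ℚᵘ.+ ℚ.toℚᵘ 1/d ℚᵘ.* ℚ.toℚᵘ R)
    ≈⟨ ℚᵘ.*-congˡ {ℚᵘ.½} (ℚᵘ.+-congʳ (ℚ.toℚᵘ A) (ℚ.toℚᵘ-homo-* 1/d R)) ⟨
  ℚᵘ.½ ℚᵘ.* (ℚ.toℚᵘ A ℚᵘ.+ ℚ.toℚᵘ (1/d ℚ.* R))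
    ≈⟨ ℚᵘ.*-congˡ {ℚᵘ.½} (ℚ.toℚᵘ-homo-+ A (1/d ℚ.* R)) ⟨
  ℚᵘ.½ ℚᵘ.* ℚ.toℚᵘ (A ℚ.+ 1/d ℚ.* R)
    ≈⟨ ℚ.toℚᵘ-homo-* ½ (A ℚ.+ 1/d ℚ.* R) ⟨
  ℚ.toℚᵘ (½ ℚ.* (A ℚ.+ 1/d ℚ.* R)) ∎)
  where
  open import Relation.Binary.Reasoning.Setoid ℚᵘ.≃-setoid
  1/2dᵘ Nᵘ aᵘ 1/dᵘ rᵘ : ℚᵘ
  1/2dᵘ = ℤ.+ 1 ℚᵘ./ (2 * d)
  Nᵘ    = ℤ.+ (a * d + r) ℚᵘ./ 1
  aᵘ    = ℤ.+ a ℚᵘ./ 1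
  1/dᵘ  = ℤ.+ 1 ℚᵘ./ d
  rᵘ    = ℤ.+ r ℚᵘ./ 1
  1/2d N A 1/d R : ℚ.ℚ
  1/2d = ℚ.fromℚᵘ 1/2dᵘ
  N    = ℚ.fromℚᵘ Nᵘ
  A    = ℚ.fromℚᵘ aᵘ
  1/d  = ℚ.fromℚᵘ 1/dᵘ
  R    = ℚ.fromℚᵘ rᵘ
  numerators : ℤ.+ (a * d + r) ≡ ℤ.+ a ℤ.* ℤ.+ (d * 1) ℤ.+ ℤ.+ 1 ℤ.* ℤ.+ r ℤ.* ℤ.+ 1
  numerators = trans (ℤ.pos-+ (a * d) r) (cong₂ ℤ._+_
    (trans (ℤ.pos-* a d) (cong (λ k → ℤ.+ a ℤ.* ℤ.+ k) (sym (*-identityʳ d))))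
    (sym (trans (ℤ.*-identityʳ (ℤ.+ 1 ℤ.* ℤ.+ r)) (ℤ.*-identityˡ (ℤ.+ r)))))
  denominators : 2 * (1 * (d * 1)) ≡ 2 * d * 1
  denominators =
    trans (cong (2 *_) (*-identityˡ (d * 1))) (sym (*-assoc 2 d 1))
  cross : ℚᵘ.↥ (1/2dᵘ ℚᵘ.* Nᵘ) ℤ.* ℚᵘ.↧ (ℚᵘ.½ ℚᵘ.* (aᵘ ℚᵘ.+ 1/dᵘ ℚᵘ.* rᵘ)) ≡
          ℚᵘ.↥ (ℚᵘ.½ ℚᵘ.* (aᵘ ℚᵘ.+ 1/dᵘ ℚᵘ.* rᵘ)) ℤ.* ℚᵘ.↧ (1/2dᵘ ℚᵘ.* Nᵘ)
  -- The unreduced fractions already agree in numerator and in denominator.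
  cross = cong₂ (λ i j → ℤ.+ 1 ℤ.* i ℤ.* ℤ.+ j) numerators denominators

-- Both inclusions rest on this identity, read in opposite directions.
halve-append : ∀ m (v r : Vec ℕ n) →
               (1/2^ suc m) *ᵥ ι (zipWith (append m) v r) ≡ ½ *ᵥ (ι v +ᵥ (1/2^ m) *ᵥ ι r)
halve-append m []      []      = refl
halve-append m (a ∷ v) (b ∷ r) =
  cong₂ _∷_ (½-append (2 ^ m) {{m^n≢0 2 m}} {{m^n≢0 2 (suc m)}} a b) (halve-append m v r)

-- Covers level 0, where the point is its own `v`: `1/2^ 0` and `½ ℚ.+ ½` both evaluate to 1.
x≡½[x+x] : (y : ℚ^ n) → (1/2^ 0) *ᵥ y ≡ ½ *ᵥ (y +ᵥ (1/2^ 0) *ᵥ y)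
x≡½[x+x] []      = refl
x≡½[x+x] (q ∷ y) = cong₂ _∷_ (begin
  ℚ.1ℚ ℚ.* q                       ≡⟨⟩
  (½ ℚ.+ ½) ℚ.* q                  ≡⟨ ℚ.*-distribʳ-+ q ½ ½ ⟩
  ½ ℚ.* q ℚ.+ ½ ℚ.* q              ≡⟨ ℚ.*-distribˡ-+ ½ q q ⟨
  ½ ℚ.* (q ℚ.+ q)                  ≡⟨ cong (λ z → ½ ℚ.* (q ℚ.+ z)) (ℚ.*-identityˡ q) ⟨
  ½ ℚ.* (q ℚ.+ ℚ.1ℚ ℚ.* q)         ∎) (x≡½[x+x] y)
  where open ≡-Reasoning

theorem4 : ∀ (n : ℕ) → ¬ (2 ∣ n) → n ≥ 3 →
    𝒫 n ≐ ⋃[ v ∶ ∃ (T n) ] (½ *ₛ (ι (proj₁ v) +ₛ 𝒫 n))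
theorem4 n _ _ = split , glue
  where
  split : ∀ {y} → 𝒫 n y → (⋃[ v ∶ ∃ (T n) ] (½ *ₛ (ι (proj₁ v) +ₛ 𝒫 n))) y
  -- P n 0 contains only the origin, which also serves as v.
  split (zero  , _ , (x , (x<1 , Σx≡0) , refl) , refl) =
    (x , All.map (λ x<1 → inj₁ (n<1⇒n≡0 x<1)) x<1 , Σx≡0) , _ ,
    (_ , (0 , _ , (x , (x<1 , Σx≡0) , refl) , refl) , refl) , x≡½[x+x] (ι x)
  -- The top digits form `v`, and the remainders lie one level lower, at `m`.
  split (suc m , _ , (x , x∈P , refl) , refl) with P-split m x∈P
  ... | v , r , v∈T , r∈P , refl =
    (v , v∈T) , _ , (_ , (m , _ , (r , r∈P , refl) , refl) , refl) , halve-append m v r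
  glue : ∀ {y} → (⋃[ v ∶ ∃ (T n) ] (½ *ₛ (ι (proj₁ v) +ₛ 𝒫 n))) y → 𝒫 n y
  -- Placing `v` on top of `r` adds one digit, hence the level `suc m`.
  glue ((v , v∈T) , _ , (_ , (m , _ , (r , r∈P , refl) , refl) , refl) , refl) =
    suc m , _ , (_ , append-∈-P m v∈T r∈P , refl) , sym (halve-append m v r)
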